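{- Let $n,k$ be integers with $n>2k\geq 4$. Then \[ m(n,k,3,2)=\binom{n-2}{k-2}. \] Moreover, if $\mathcal{F}\subset\binom{[n]}{k}$ is $3$-wise $2$-intersecting with $|\mathcal{F}|=\binom{n-2}{k-2}$, then $\mathcal{F}$ is a full $2$-star, i.e. $\mathcal{F}=\{F\in\binom{[n]}{k}: T\subset F\}$ for some $2$-element set $T\subset[n]$.
   Context: $\binom{[n]}{k}$ is the set of $k$-element subsets of $[n]=\{1,\dots,n\}$. A family $\mathcal{F}$ is $r$-wise $t$-intersecting if $|F_1\cap\dots\cap F_r|\geq t$ for all (not necessarily distinct) $F_1,\dots,F_r\in\mathcal{F}$. $m(n,k,r,t)$ is the maximum of $|\mathcal{F}|$ over all $r$-wise $t$-intersecting families $\mathcal{F}\subset\binom{[n]}{k}$. -}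

module Defs where

open import Data.Nat using (ℕ)
open import Data.Fin.Subset using (Subset; ∣_∣; _∩_; _⊆_)
open import Data.List using (List)
open import Data.List.Membership.Propositional using (_∈_)
open import Data.List.Relation.Unary.All using (All)
open import Data.List.Relation.Unary.Unique.Propositional using (Unique)
open import Data.Nat using (_≤_)
open import Data.Product using (_×_)
open import Function.Bundles using (_⇔_)
open import Relation.Binary.PropositionalEquality using (_≡_)

-- A family F ⊂ binom([n],k): a duplicate-free list of subsets of Fin n,
-- each of cardinality k.  Its size |F| is the list length.
IsKFamily : (n k : ℕ) → List (Subset n) → Set
IsKFamily n k F = Unique F × All (λ A → ∣ A ∣ ≡ k) F

ThreeWiseTwoIntersecting : {n : ℕ} → List (Subset n) → Set
ThreeWiseTwoIntersecting {n} F =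
  ∀ {A B C : Subset n} → A ∈ F → B ∈ F → C ∈ F → 2 ≤ ∣ A ∩ (B ∩ C) ∣

IsFullStar : {n : ℕ} → ℕ → Subset n → List (Subset n) → Set
IsFullStar {n} k T F = ∣ T ∣ ≡ 2 × (∀ (G : Subset n) → (G ∈ F) ⇔ (∣ G ∣ ≡ k × T ⊆ G))

{-# OPTIONS --safe #-}
module Submission where

open import Defs
open import Data.Nat using (ℕ; _≤_; _<_; _*_)
open import Data.Nat.Combinatorics using (_C_)
open import Data.Nat using (_∸_)
open import Data.Fin.Subset using (Subset)
open import Data.List using (List; length)
open import Data.Product using (_×_; Σ; ∃; ∃-syntax)
open import Relation.Binary.PropositionalEquality using (_≡_)
open import Data.Nat using (zero; suc; _+_; z≤n; s≤s)
open import Data.Nat.Properties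
open import Algebra.Properties.CommutativeSemigroup +-commutativeSemigroup using (interchange; x∙yz≈y∙xz)
open import Data.Nat.Tactic.RingSolver using (solve-∀)
open import Data.Nat.Combinatorics using (nCk+nC[k+1]≡[n+1]C[k+1]; nC1≡n; k>n⇒nCk≡0)
open import Data.Bool using (Bool; true; false; _∧_; _∨_; if_then_else_) renaming (_≟_ to _≟ᵇ_)
open import Data.Bool.Properties using (∧-conicalˡ; ∧-conicalʳ; ∧-zeroʳ)
open import Data.Empty using (⊥; ⊥-elim)
open import Data.Fin using (Fin; zero; suc)
open import Data.Fin.Subset using (∣_∣; _∩_; _⊆_)
open import Data.Fin.Subset.Properties using (∩-idem; ∣p∩q∣≤∣q∣; p⊆q⇒∣p∣≤∣q∣; x∈p∩q⁺)
open import Data.List using ([]; _∷_; _++_; map; foldr; allFin)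
open import Data.List.Properties using (length-map; length-++)
open import Data.List.Membership.Propositional using (_∈_; find; lose)
import Data.List.Membership.DecPropositional as DecPropositional
open import Data.List.Membership.Propositional.Properties using (∈-allFin; ∈-map⁻)
open import Data.List.Relation.Unary.Any using (here; there; any?)
open import Data.List.Relation.Unary.All as All using (All; []; _∷_)
open import Data.List.Relation.Unary.All.Properties using (¬Any⇒All¬; All¬⇒¬Any) renaming (map⁺ to All-map⁺; ++⁺ to All-++⁺)
open import Data.List.Relation.Unary.AllPairs using ([]; _∷_)
open import Data.List.Relation.Unary.Unique.Propositional.Properties using () renaming (map⁺ to Unique-map⁺; ++⁺ to Unique-++⁺)
open import Data.Product using (_,_; proj₁; proj₂)
open import Data.Sum using (_⊎_; inj₁; inj₂)
open import Data.Vec using ([]; _∷_; here; there; lookup; _[_]≔_)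
open import Data.Vec.Properties using (lookup∘updateAt; []≔-idempotent; []≔-lookup; lookup-zipWith; ∷-injectiveʳ; ≡-dec)
open import Function using (_∘_; mk⇔)
open import Relation.Binary using (tri<; tri≈; tri>)
open import Relation.Nullary using (¬_; Dec; yes; no; does; contradiction)
open import Relation.Nullary.Decidable using (_×-dec_; _⊎-dec_; dec-true; dec-false)
open import Relation.Binary.PropositionalEquality using (_≢_; refl; sym; trans; cong; cong₂; subst; subst₂; module ≡-Reasoning)

-- Consider families T of arbitrary subsets of [m], weighted by the number C(n-m, k-|A|) of k-subsets of
-- [n] with trace A, and remove the element m (here: the head 0) one at a time. After shifting the
-- element m to every other one, the traces of T are A with A ∈ T (T₀) and A with A ∪ {m} ∈ T (T₁), and all
-- of T₀ together with any subfamily of T₁ is again 3-wise 2-intersecting unless it contains three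
-- sets with pairwise disjoint complements and a single common element. Averaging the weights of
-- 2(n-m+1) + 1 such conflict-free subfamilies shows that one of them weighs at least as much as T when
-- n > 2k, which leads down to m = 2, where the bound is clear.
-- If two members of F meet in exactly 2 elements, these are contained in all members. Otherwise F is
-- also 2-wise 3-intersecting; this survives shifting and the subfamily "halved", so that
-- the same induction ends with an empty family and gives a strict inequality.

-- Sums over subsets and over initial segments

bit : Bool → ℕ
bit true  = 1
bit false = 0

Σ⊆ : (m : ℕ) → (Subset m → ℕ) → ℕ
Σ⊆ zero    f = f []
Σ⊆ (suc m) f = Σ⊆ m (f ∘ (true ∷_)) + Σ⊆ m (f ∘ (false ∷_))

Σ⊆-mono : ∀ m {f g : Subset m → ℕ} → (∀ A → f A ≤ g A) → Σ⊆ m f ≤ Σ⊆ m g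
Σ⊆-mono zero    p = p []
Σ⊆-mono (suc m) p = +-mono-≤ (Σ⊆-mono m (p ∘ (true ∷_))) (Σ⊆-mono m (p ∘ (false ∷_)))

Σ⊆-cong : ∀ m {f g : Subset m → ℕ} → (∀ A → f A ≡ g A) → Σ⊆ m f ≡ Σ⊆ m g
Σ⊆-cong zero    p = p []
Σ⊆-cong (suc m) p = cong₂ _+_ (Σ⊆-cong m (p ∘ (true ∷_))) (Σ⊆-cong m (p ∘ (false ∷_)))

Σ⊆-+ : ∀ m (f g : Subset m → ℕ) → Σ⊆ m (λ A → f A + g A) ≡ Σ⊆ m f + Σ⊆ m g
Σ⊆-+ zero    f g = refl
Σ⊆-+ (suc m) f g = trans
  (cong₂ _+_ (Σ⊆-+ m (f ∘ (true ∷_)) (g ∘ (true ∷_))) (Σ⊆-+ m (f ∘ (false ∷_)) (g ∘ (false ∷_))))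
  (interchange (Σ⊆ m (f ∘ (true ∷_))) _ _ _)

Σ⊆-*ˡ : ∀ m c (f : Subset m → ℕ) → Σ⊆ m (λ A → c * f A) ≡ c * Σ⊆ m f
Σ⊆-*ˡ zero    c f = refl
Σ⊆-*ˡ (suc m) c f = trans
  (cong₂ _+_ (Σ⊆-*ˡ m c (f ∘ (true ∷_))) (Σ⊆-*ˡ m c (f ∘ (false ∷_))))
  (sym (*-distribˡ-+ c _ _))

Σ≤ : ℕ → (ℕ → ℕ) → ℕ
Σ≤ zero    f = f 0
Σ≤ (suc N) f = f 0 + Σ≤ N (f ∘ suc)

Σ≤-last : ∀ N f → Σ≤ (suc N) f ≡ f (suc N) + Σ≤ N f
Σ≤-last zero    f = +-comm (f 0) (f 1)
Σ≤-last (suc N) f = begin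
  f 0 + Σ≤ (suc N) (f ∘ suc)          ≡⟨ cong (f 0 +_) (Σ≤-last N (f ∘ suc)) ⟩
  f 0 + (f (2 + N) + Σ≤ N (f ∘ suc))  ≡⟨ x∙yz≈y∙xz (f 0) (f (2 + N)) _ ⟩
  f (2 + N) + (f 0 + Σ≤ N (f ∘ suc))  ∎
  where
  open ≡-Reasoning

Σ≤-cong : ∀ N {f g} → (∀ j → j ≤ N → f j ≡ g j) → Σ≤ N f ≡ Σ≤ N g
Σ≤-cong zero    p = p 0 z≤n
Σ≤-cong (suc N) p = cong₂ _+_ (p 0 z≤n) (Σ≤-cong N (λ j j≤N → p (suc j) (s≤s j≤N)))

Σ≤-mono : ∀ N {f g} → (∀ j → j ≤ N → f j ≤ g j) → Σ≤ N f ≤ Σ≤ N g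
Σ≤-mono zero    p = p 0 z≤n
Σ≤-mono (suc N) p = +-mono-≤ (p 0 z≤n) (Σ≤-mono N (λ j j≤N → p (suc j) (s≤s j≤N)))

Σ≤-const : ∀ N c → Σ≤ N (λ _ → c) ≡ suc N * c
Σ≤-const zero    c = sym (+-identityʳ c)
Σ≤-const (suc N) c = cong (c +_) (Σ≤-const N c)

Σ≤-reverse : ∀ N f → Σ≤ N (λ j → f (N ∸ j)) ≡ Σ≤ N f
Σ≤-reverse zero    f = refl
Σ≤-reverse (suc N) f = trans (cong (f (suc N) +_) (Σ≤-reverse N f)) (sym (Σ≤-last N f))

Σ≤-count : ∀ N r c f → r ≤ N → (∀ j → j ≤ r → c ≤ f j) → suc r * c ≤ Σ≤ N f
Σ≤-count zero    zero    c f z≤n       p = ≤-trans (≤-reflexive (*-identityˡ c)) (p 0 z≤n)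
Σ≤-count (suc N) zero    c f z≤n       p = +-mono-≤ (p 0 z≤n) z≤n
Σ≤-count (suc N) (suc r) c f (s≤s r≤N) p =
  +-mono-≤ (p 0 z≤n) (Σ≤-count N r c (f ∘ suc) r≤N (λ j j≤r → p (suc j) (s≤s j≤r)))

Σ≤-*ʳ : ∀ N f c → Σ≤ N (λ j → f j * c) ≡ Σ≤ N f * c
Σ≤-*ʳ zero    f c = refl
Σ≤-*ʳ (suc N) f c = trans (cong (f 0 * c +_) (Σ≤-*ʳ N (f ∘ suc) c)) (sym (*-distribʳ-+ c (f 0) _))

Σ⊆-Σ≤ : ∀ m N (F : ℕ → Subset m → ℕ) → Σ⊆ m (λ A → Σ≤ N (λ j → F j A)) ≡ Σ≤ N (λ j → Σ⊆ m (F j))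
Σ⊆-Σ≤ m zero    F = refl
Σ⊆-Σ≤ m (suc N) F = trans (Σ⊆-+ m (F 0) _) (cong (Σ⊆ m (F 0) +_) (Σ⊆-Σ≤ m N (F ∘ suc)))

-- Families and the shift operation

Family : ℕ → Set
Family m = Subset m → Bool

ThreeWise : ∀ {m} → Family m → Set
ThreeWise T = ∀ A B E → T A ≡ true → T B ≡ true → T E ≡ true → 2 ≤ ∣ A ∩ (B ∩ E) ∣

PairWise : ∀ {m} → Family m → Set
PairWise T = ∀ A B → T A ≡ true → T B ≡ true → 3 ≤ ∣ A ∩ B ∣

∣∷∣ : ∀ {m} b (A : Subset m) → ∣ b ∷ A ∣ ≡ bit b + ∣ A ∣
∣∷∣ true  A = refl
∣∷∣ false A = refl

∣split∣ : ∀ {m} (x : Fin m) (A : Subset m) → ∣ A ∣ ≡ bit (lookup A x) + ∣ A [ x ]≔ false ∣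
∣split∣ zero    (b ∷ A) = ∣∷∣ b A
∣split∣ (suc x) (b ∷ A) = begin
  ∣ b ∷ A ∣                                       ≡⟨ ∣∷∣ b A ⟩
  bit b + ∣ A ∣                                   ≡⟨ cong (bit b +_) (∣split∣ x A) ⟩
  bit b + (bit (lookup A x) + ∣ A [ x ]≔ false ∣) ≡⟨ x∙yz≈y∙xz (bit b) (bit (lookup A x)) _ ⟩
  bit (lookup A x) + (bit b + ∣ A [ x ]≔ false ∣) ≡⟨ cong (bit (lookup A x) +_) (∣∷∣ b (A [ x ]≔ false)) ⟨
  bit (lookup A x) + ∣ b ∷ (A [ x ]≔ false) ∣     ∎
  where
  open ≡-Reasoning

[]≔-∩ : ∀ {m} (x : Fin m) (A B : Subset m) →
  (A ∩ B) [ x ]≔ false ≡ (A [ x ]≔ false) ∩ (B [ x ]≔ false)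
[]≔-∩ zero    (a ∷ A) (b ∷ B) = refl
[]≔-∩ (suc x) (a ∷ A) (b ∷ B) = cong ((a ∧ b) ∷_) ([]≔-∩ x A B)

module Shift {m : ℕ} (x : Fin m) where

  -- The transposition of 0 and `suc x`, acting on subsets.
  swap : Subset (suc m) → Subset (suc m)
  swap (b ∷ A) = lookup A x ∷ (A [ x ]≔ b)

  swap-involutive : ∀ A → swap (swap A) ≡ A
  swap-involutive (b ∷ A) = cong₂ _∷_ (lookup∘updateAt x A)
    (trans ([]≔-idempotent A x) ([]≔-lookup A x))

  -- The trace outside both exchanged elements; position `x` is emptied rather than deleted, so the
  -- length stays `m`.
  rest : Subset (suc m) → Subset m
  rest (b ∷ A) = A [ x ]≔ false

  at-0 at-x : Subset (suc m) → Bool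
  at-0 (b ∷ A) = b
  at-x (b ∷ A) = lookup A x

  ∣rest∣ : ∀ A → ∣ A ∣ ≡ bit (at-0 A) + (bit (at-x A) + ∣ rest A ∣)
  ∣rest∣ (b ∷ A) = trans (∣∷∣ b A) (cong (bit b +_) (∣split∣ x A))

  at-0-∩ : ∀ A B → at-0 (A ∩ B) ≡ at-0 A ∧ at-0 B
  at-0-∩ (a ∷ A) (b ∷ B) = refl

  at-x-∩ : ∀ A B → at-x (A ∩ B) ≡ at-x A ∧ at-x B
  at-x-∩ (a ∷ A) (b ∷ B) = lookup-zipWith _∧_ x A B

  rest-∩ : ∀ A B → rest (A ∩ B) ≡ rest A ∩ rest B
  rest-∩ (a ∷ A) (b ∷ B) = []≔-∩ x A B

  at-0-swap : ∀ A → at-0 (swap A) ≡ at-x A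
  at-0-swap (b ∷ A) = refl

  at-x-swap : ∀ A → at-x (swap A) ≡ at-0 A
  at-x-swap (b ∷ A) = lookup∘updateAt x A

  rest-swap : ∀ A → rest (swap A) ≡ rest A
  rest-swap (b ∷ A) = []≔-idempotent A x

  swap-fixed : ∀ A → at-0 A ≡ at-x A → swap A ≡ A
  swap-fixed (b ∷ A) refl = cong (lookup A x ∷_) ([]≔-lookup A x)

  ∣swap∣ : ∀ A → ∣ swap A ∣ ≡ ∣ A ∣
  ∣swap∣ A = begin
    ∣ swap A ∣
      ≡⟨ ∣rest∣ (swap A) ⟩
    bit (at-0 (swap A)) + (bit (at-x (swap A)) + ∣ rest (swap A) ∣)
      ≡⟨ cong₂ _+_ (cong bit (at-0-swap A)) (cong₂ _+_ (cong bit (at-x-swap A)) (cong ∣_∣ (rest-swap A))) ⟩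
    bit (at-x A) + (bit (at-0 A) + ∣ rest A ∣)
      ≡⟨ x∙yz≈y∙xz (bit (at-x A)) (bit (at-0 A)) _ ⟩
    bit (at-0 A) + (bit (at-x A) + ∣ rest A ∣)
      ≡⟨ ∣rest∣ A ⟨
    ∣ A ∣ ∎
    where
    open ≡-Reasoning

  -- The compression replacing 0 by `x`. On sets fixed by `swap` both branches reduce to `T A`, so
  -- the formula also covers sets with both or neither of the two elements.
  shift : Family (suc m) → Family (suc m)
  shift T A = if at-0 A then T A ∧ T (swap A) else T A ∨ T (swap A)

Σ⊆-swap : ∀ {m} (x : Fin m) (f : Subset (suc m) → ℕ) → Σ⊆ (suc m) (f ∘ Shift.swap x) ≡ Σ⊆ (suc m) f
Σ⊆-swap {suc m} zero    f = interchange (Σ⊆ m (f ∘ (true ∷_) ∘ (true ∷_))) _ _ _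
Σ⊆-swap {suc m} (suc x) f = begin
  (s true true + s true false) + (s false true + s false false)
    ≡⟨ interchange (s true true) _ _ _ ⟩
  (s true true + s false true) + (s true false + s false false)
    ≡⟨ cong₂ _+_ (Σ⊆-swap x (λ { (b ∷ A) → f (b ∷ true ∷ A) }))
                 (Σ⊆-swap x (λ { (b ∷ A) → f (b ∷ false ∷ A) })) ⟩
  (t true true + t false true) + (t true false + t false false)
    ≡⟨ interchange (t true true) _ _ _ ⟩
  (t true true + t true false) + (t false true + t false false) ∎
  where
  open ≡-Reasoning
  s t : Bool → Bool → ℕ
  s b c = Σ⊆ m (λ A → f (lookup A x ∷ c ∷ (A [ x ]≔ b)))
  t b c = Σ⊆ m (λ A → f (b ∷ c ∷ A))


W : (m : ℕ) → (ℕ → ℕ) → Family m → ℕ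
W m w T = Σ⊆ m (λ A → bit (T A) * w ∣ A ∣)

module _ {m : ℕ} (x : Fin m) where
  open Shift x

  shift-swap : ∀ T A → shift T (swap A) ≡ (if at-x A then T (swap A) ∧ T A else T (swap A) ∨ T A)
  shift-swap T A = cong₂ (λ b B → if b then T (swap A) ∧ T B else T (swap A) ∨ T B)
    (at-0-swap A) (swap-involutive A)

  -- Shifting acts within the orbit of `A` under `swap`: a fixed set keeps its status, and in an
  -- orbit of two the conjunction and the disjunction together count as much as the original pair.
  shift-orbit : ∀ T A → bit (shift T A) + bit (shift T (swap A)) ≡ bit (T A) + bit (T (swap A))
  shift-orbit T A rewrite shift-swap T A with at-0 A | at-x A | swap-fixed A
  ... | true  | true  | fixed rewrite fixed refl with T A
  ...   | true  = refl
  ...   | false = refl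
  shift-orbit T A | false | false | fixed rewrite fixed refl with T A
  ...   | true  = refl
  ...   | false = refl
  shift-orbit T A | true  | false | _ with T A | T (swap A)
  ...   | true  | true  = refl
  ...   | true  | false = refl
  ...   | false | true  = refl
  ...   | false | false = refl
  shift-orbit T A | false | true  | _ with T A | T (swap A)
  ...   | true  | true  = refl
  ...   | true  | false = refl
  ...   | false | true  = refl
  ...   | false | false = refl

  W-swap : ∀ w T → W (suc m) w (T ∘ swap) ≡ W (suc m) w T
  W-swap w T = trans
    (Σ⊆-cong (suc m) (λ A → cong (λ a → bit (T (swap A)) * w a) (sym (∣swap∣ A))))
    (Σ⊆-swap x (λ A → bit (T A) * w ∣ A ∣))

  -- Doubling pairs each set with its image. As `swap` preserves sizes, the orbit identity applies
  -- pointwise, and the factor 2 cancels.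
  W-shift : ∀ w T → W (suc m) w (shift T) ≡ W (suc m) w T
  W-shift w T = *-cancelˡ-≡ _ _ 2 (begin
    2 * W (suc m) w (shift T)                                 ≡⟨ double (shift T) ⟩
    Σ⊆ (suc m) (λ A → (bit (shift T A) + bit (shift T (swap A))) * w ∣ A ∣)
      ≡⟨ Σ⊆-cong (suc m) (λ A → cong (_* w ∣ A ∣) (shift-orbit T A)) ⟩
    Σ⊆ (suc m) (λ A → (bit (T A) + bit (T (swap A))) * w ∣ A ∣) ≡⟨ double T ⟨
    2 * W (suc m) w T                                         ∎)
    where
    open ≡-Reasoning
    double : ∀ T → 2 * W (suc m) w T ≡ Σ⊆ (suc m) (λ A → (bit (T A) + bit (T (swap A))) * w ∣ A ∣)
    double T = begin
      2 * W (suc m) w T                         ≡⟨ cong (W (suc m) w T +_) (+-identityʳ _) ⟩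
      W (suc m) w T + W (suc m) w T             ≡⟨ cong (W (suc m) w T +_) (W-swap w T) ⟨
      W (suc m) w T + W (suc m) w (T ∘ swap)    ≡⟨ Σ⊆-+ (suc m) (λ A → bit (T A) * w ∣ A ∣) (λ A → bit (T (swap A)) * w ∣ A ∣) ⟨
      Σ⊆ (suc m) (λ A → bit (T A) * w ∣ A ∣ + bit (T (swap A)) * w ∣ A ∣)
        ≡⟨ Σ⊆-cong (suc m) (λ A → sym (*-distribʳ-+ (w ∣ A ∣) (bit (T A)) (bit (T (swap A))))) ⟩
      Σ⊆ (suc m) (λ A → (bit (T A) + bit (T (swap A))) * w ∣ A ∣) ∎

  module _ (T : Family (suc m)) where

    -- A member of `T` behind each member of the shifted family. Preferring `swap A` matters: a
    -- shifted set with 0 but without `x` is thereby represented by a version avoiding 0.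
    unshift : Subset (suc m) → Subset (suc m)
    unshift A = if T (swap A) then swap A else A

    unshift-∈ : ∀ A → shift T A ≡ true → T (unshift A) ≡ true
    unshift-∈ A h with T (swap A) in eq | at-0 A
    ... | true  | _     = eq
    ... | false | true  = contradiction (∧-conicalʳ (T A) false h) λ ()
    ... | false | false with T A | h
    ...   | true | _ = refl

    rest-unshift : ∀ A → rest (unshift A) ≡ rest A
    rest-unshift A with T (swap A)
    ... | true  = rest-swap A
    ... | false = refl

    at-0-unshift : ∀ A → shift T A ≡ true → at-0 (unshift A) ≡ true → at-x A ≡ true
    at-0-unshift A h h₀ with T (swap A)
    ... | true  = trans (sym (at-0-swap A)) h₀
    ... | false rewrite h₀ = contradiction (∧-conicalʳ (T A) false h) λ ()

    at-x-unshift-new : ∀ A → shift T A ≡ true → T A ≡ false → at-x (unshift A) ≡ false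
    at-x-unshift-new A h new with at-0 A in eq
    ... | true rewrite new = contradiction h λ ()
    ... | false rewrite new | h = trans (at-x-swap A) eq

    private
      ∩₃ : Subset (suc m) → Subset (suc m) → Subset (suc m) → Subset (suc m)
      ∩₃ A B E = A ∩ (B ∩ E)

      on-∩₃ : (at : Subset (suc m) → Bool) → (∀ A B → at (A ∩ B) ≡ at A ∧ at B) →
        ∀ A B E → at (∩₃ A B E) ≡ at A ∧ (at B ∧ at E)
      on-∩₃ at at-∩ A B E = trans (at-∩ A (B ∩ E)) (cong (at A ∧_) (at-∩ B E))

      rest-∩₃ : ∀ A B E → rest (∩₃ A B E) ≡ rest A ∩ (rest B ∩ rest E)
      rest-∩₃ A B E = trans (rest-∩ A (B ∩ E)) (cong (rest A ∩_) (rest-∩ B E))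

      ∧-false : ∀ {a b c} → a ≡ false ⊎ b ≡ false ⊎ c ≡ false → a ∧ (b ∧ c) ≡ false
      ∧-false {false} _ = refl
      ∧-false {true} {false} _ = refl
      ∧-false {true} {true} {false} _ = refl
      ∧-false {true} {true} {true} (inj₁ ())
      ∧-false {true} {true} {true} (inj₂ (inj₁ ()))
      ∧-false {true} {true} {true} (inj₂ (inj₂ ()))

    -- If one of the sets is new then its preimage misses x, so the preimages have at most the
    -- element 0 in common besides the rest, and only when all three sets contain x.
    unshift-∩ : ∀ A B E → shift T A ≡ true → shift T B ≡ true → shift T E ≡ true →
      T A ≡ false ⊎ T B ≡ false ⊎ T E ≡ false →
      ∣ ∩₃ (unshift A) (unshift B) (unshift E) ∣ ≤ ∣ ∩₃ A B E ∣
    unshift-∩ A B E hA hB hE new = begin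
      ∣ D′ ∣                                           ≡⟨ ∣rest∣ D′ ⟩
      bit (at-0 D′) + (bit (at-x D′) + ∣ rest D′ ∣)    ≡⟨ cong₂ (λ b r → bit (at-0 D′) + (bit b + ∣ r ∣)) x∉D′ rest≡ ⟩
      bit (at-0 D′) + ∣ rest D ∣                       ≤⟨ +-monoˡ-≤ ∣ rest D ∣ 0≤x ⟩
      bit (at-x D) + ∣ rest D ∣                        ≤⟨ m≤n+m _ (bit (at-0 D)) ⟩
      bit (at-0 D) + (bit (at-x D) + ∣ rest D ∣)       ≡⟨ ∣rest∣ D ⟨
      ∣ D ∣                                            ∎
      where
      open ≤-Reasoning
      D  = ∩₃ A B E
      D′ = ∩₃ (unshift A) (unshift B) (unshift E)
      x∉D′ : at-x D′ ≡ false
      x∉D′ = trans (on-∩₃ at-x at-x-∩ (unshift A) (unshift B) (unshift E)) (∧-false (go new))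
        where
        go : T A ≡ false ⊎ T B ≡ false ⊎ T E ≡ false →
          at-x (unshift A) ≡ false ⊎ at-x (unshift B) ≡ false ⊎ at-x (unshift E) ≡ false
        go (inj₁ n)        = inj₁ (at-x-unshift-new A hA n)
        go (inj₂ (inj₁ n)) = inj₂ (inj₁ (at-x-unshift-new B hB n))
        go (inj₂ (inj₂ n)) = inj₂ (inj₂ (at-x-unshift-new E hE n))
      rest≡ : rest D′ ≡ rest D
      rest≡ = trans (rest-∩₃ (unshift A) (unshift B) (unshift E)) (trans
        (cong₂ _∩_ (rest-unshift A) (cong₂ _∩_ (rest-unshift B) (rest-unshift E)))
        (sym (rest-∩₃ A B E)))
      0≤x : bit (at-0 D′) ≤ bit (at-x D)
      0≤x with at-0 D′ in eq
      ... | false = z≤n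
      ... | true  = ≤-reflexive (cong bit (sym x∈D))
        where
        all-0 : at-0 (unshift A) ∧ (at-0 (unshift B) ∧ at-0 (unshift E)) ≡ true
        all-0 = trans (sym (on-∩₃ at-0 at-0-∩ (unshift A) (unshift B) (unshift E))) eq
        x∈D : at-x D ≡ true
        x∈D = trans (on-∩₃ at-x at-x-∩ A B E) (cong₂ _∧_
          (at-0-unshift A hA (∧-conicalˡ _ _ all-0))
          (cong₂ _∧_
            (at-0-unshift B hB (∧-conicalˡ _ _ (∧-conicalʳ (at-0 (unshift A)) _ all-0)))
            (at-0-unshift E hE (∧-conicalʳ _ _ (∧-conicalʳ (at-0 (unshift A)) _ all-0)))))

    shift-∩ : ∀ A B E → shift T A ≡ true → shift T B ≡ true → shift T E ≡ true →
      (T A ≡ true × T B ≡ true × T E ≡ true) ⊎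
      (∣ ∩₃ (unshift A) (unshift B) (unshift E) ∣ ≤ ∣ ∩₃ A B E ∣)
    shift-∩ A B E hA hB hE with all-or-new (T A) (T B) (T E)
      where
      all-or-new : ∀ a b c → (a ≡ true × b ≡ true × c ≡ true) ⊎ (a ≡ false ⊎ b ≡ false ⊎ c ≡ false)
      all-or-new true  true  true  = inj₁ (refl , refl , refl)
      all-or-new false _     _     = inj₂ (inj₁ refl)
      all-or-new true  false _     = inj₂ (inj₂ (inj₁ refl))
      all-or-new true  true  false = inj₂ (inj₂ (inj₂ refl))
    ... | inj₁ old = inj₁ old
    ... | inj₂ new = inj₂ (unshift-∩ A B E hA hB hE new)

    shift-ThreeWise : ThreeWise T → ThreeWise (shift T)
    shift-ThreeWise int A B E hA hB hE with shift-∩ A B E hA hB hE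
    ... | inj₁ (a , b , c) = int A B E a b c
    ... | inj₂ le = ≤-trans
      (int _ _ _ (unshift-∈ A hA) (unshift-∈ B hB) (unshift-∈ E hE)) le

    shift-PairWise : PairWise T → PairWise (shift T)
    -- The three-set comparison with `B` repeated; idempotence of `∩` collapses the copies.
    shift-PairWise int A B hA hB with shift-∩ A B B hA hB hB
    ... | inj₁ (a , b , _) = int A B a b
    ... | inj₂ le = ≤-trans (int _ _ (unshift-∈ A hA) (unshift-∈ B hB))
      (subst₂ (λ X Y → ∣ unshift A ∩ X ∣ ≤ ∣ A ∩ Y ∣) (∩-idem (unshift B)) (∩-idem B) le)

-- Families stable under all shifts

Stable : ∀ {m} → Fin m → Family (suc m) → Set
Stable x T = ∀ A → T (true ∷ A) ≡ true → lookup A x ≡ false → T (false ∷ (A [ x ]≔ true)) ≡ true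

∨-introˡ : ∀ {a} b → a ≡ true → a ∨ b ≡ true
∨-introˡ b refl = refl

module _ {m : ℕ} (x : Fin m) (T : Family (suc m)) where
  open Shift x

  shift-Stable : Stable x (shift T)
  shift-Stable A h x∉A = ∨-introˡ _ (subst (λ b → T (b ∷ (A [ x ]≔ true)) ≡ true) x∉A
    (∧-conicalʳ (T (true ∷ A)) _ h))

  -- Shifting removes sets containing 0 and adds sets avoiding 0.
  shift-keeps-Stable : ∀ y → Stable y T → Stable y (shift T)
  shift-keeps-Stable y st A h y∉A = ∨-introˡ _ (st A (∧-conicalˡ _ _ h) y∉A)

record Normal {m} (w : ℕ → ℕ) (T : Family (suc m)) : Set where
  field
    family    : Family (suc m)
    stable    : ∀ x → Stable x family
    weight    : W (suc m) w family ≡ W (suc m) w T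
    threeWise : ThreeWise T → ThreeWise family
    pairWise  : PairWise T → PairWise family

-- A single pass through all elements suffices, since each later shift preserves the stability
-- reached earlier.
normalise : ∀ {m} w (T : Family (suc m)) → Normal w T
normalise {m} w T = record
  { family    = shifts (allFin m)
  ; stable    = λ x → stable (allFin m) (∈-allFin x)
  ; weight    = weight (allFin m)
  ; threeWise = λ int → threeWise int (allFin m)
  ; pairWise  = λ int → pairWise int (allFin m)
  }
  where
  shifts : List (Fin m) → Family (suc m)
  shifts = foldr (λ x → Shift.shift x) T
  stable : ∀ xs {x} → x ∈ xs → Stable x (shifts xs)
  stable (y ∷ xs) (here refl) = shift-Stable y (shifts xs)
  stable (y ∷ xs) (there x∈) = shift-keeps-Stable y (shifts xs) _ (stable xs x∈)
  weight : ∀ xs → W (suc m) w (shifts xs) ≡ W (suc m) w T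
  weight []       = refl
  weight (y ∷ xs) = trans (W-shift y w (shifts xs)) (weight xs)
  threeWise : ThreeWise T → ∀ xs → ThreeWise (shifts xs)
  threeWise int []       = int
  threeWise int (y ∷ xs) = shift-ThreeWise y (shifts xs) (threeWise int xs)
  pairWise : PairWise T → ∀ xs → PairWise (shifts xs)
  pairWise int []       = int
  pairWise int (y ∷ xs) = shift-PairWise y (shifts xs) (pairWise int xs)

-- Extension counts and binomial identities

-- wt N k a is the number of ways to extend a set of size a by N further points to a set of size k:
-- N C (k ∸ a) if a ≤ k, and 0 otherwise.
wt : ℕ → ℕ → ℕ → ℕ
wt N k       zero    = N C k
wt N zero    (suc a) = 0
wt N (suc k) (suc a) = wt N k a

wt-pascal : ∀ N k a → wt N k (suc a) + wt N k a ≡ wt (suc N) k a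
wt-pascal N zero    zero    = refl
wt-pascal N (suc k) zero    = nCk+nC[k+1]≡[n+1]C[k+1] N k
wt-pascal N zero    (suc a) = refl
wt-pascal N (suc k) (suc a) = wt-pascal N k a

C-absorb : ∀ n k → suc k * (suc n C suc k) ≡ suc n * (n C k)
C-absorb zero    zero    = refl
C-absorb zero    (suc k) = begin
  (2 + k) * (1 C (2 + k)) ≡⟨ cong ((2 + k) *_) (k>n⇒nCk≡0 (s≤s (s≤s (z≤n {k})))) ⟩
  (2 + k) * 0             ≡⟨ *-zeroʳ (2 + k) ⟩
  0                       ≡⟨ k>n⇒nCk≡0 (s≤s (z≤n {k})) ⟨
  0 C suc k               ≡⟨ *-identityˡ (0 C suc k) ⟨
  1 * (0 C suc k)         ∎
  where open ≡-Reasoning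
C-absorb (suc n) zero    = begin
  1 * ((2 + n) C 1)       ≡⟨ *-identityˡ _ ⟩
  (2 + n) C 1             ≡⟨ nC1≡n (2 + n) ⟩
  2 + n                   ≡⟨ *-identityʳ (2 + n) ⟨
  (2 + n) * 1             ∎
  where open ≡-Reasoning
C-absorb (suc n) (suc k) = begin
  (2 + k) * ((2 + n) C (2 + k))
    ≡⟨ cong ((2 + k) *_) (nCk+nC[k+1]≡[n+1]C[k+1] (suc n) (suc k)) ⟨
  (2 + k) * (p + q)
    ≡⟨ expand (suc k) p q ⟩
  p + (suc k * p + (2 + k) * q)
    ≡⟨ cong (p +_) (cong₂ _+_ (C-absorb n k) (C-absorb n (suc k))) ⟩
  p + (suc n * (n C k) + suc n * (n C suc k))
    ≡⟨ cong (p +_) (*-distribˡ-+ (suc n) (n C k) (n C suc k)) ⟨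
  p + suc n * (n C k + n C suc k)
    ≡⟨ cong (λ r → p + suc n * r) (nCk+nC[k+1]≡[n+1]C[k+1] n k) ⟩
  (2 + n) * p ∎
  where
  open ≡-Reasoning
  p q : ℕ
  p = suc n C suc k
  q = suc n C (2 + k)
  expand : ∀ k p q → suc k * (p + q) ≡ p + (k * p + suc k * q)
  expand = solve-∀

-- The absorption identity (N + 1) C(N, k - a - 1) = (k - a) C(N + 1, k - a), with the term in `a`
-- moved to the left to avoid subtraction; for a > k both weights vanish.
wt-absorb : ∀ N k a → suc N * wt N k (suc a) + a * wt (suc N) k a ≡ k * wt (suc N) k a
wt-absorb N zero    zero    = trans (+-identityʳ _) (*-zeroʳ (suc N))
wt-absorb N (suc k) zero    = trans (+-identityʳ _) (sym (C-absorb N k))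
wt-absorb N zero    (suc a) = cong₂ _+_ (*-zeroʳ (suc N)) (*-zeroʳ (suc a))
wt-absorb N (suc k) (suc a) = trans
  (x∙yz≈y∙xz (suc N * wt N k (suc a)) (wt (suc N) k a) (a * wt (suc N) k a))
  (cong (wt (suc N) k a +_) (wt-absorb N k a))

wt-0 : ∀ N k a → k < a → wt N k a ≡ 0
wt-0 N zero    (suc a) _         = refl
wt-0 N (suc k) (suc a) (s≤s k<a) = wt-0 N k a k<a

-- Covering sets and the removal of 0

Covering₂ : ∀ {m} → Subset m → Subset m → Set
Covering₂ A B = ∀ x → lookup A x ≡ false → lookup B x ≡ true

-- Inclusion-exclusion, the union being the whole ground set.
∣∣-covering₂ : ∀ {m} (A B : Subset m) → Covering₂ A B → ∣ A ∣ + ∣ B ∣ ≡ m + ∣ A ∩ B ∣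
∣∣-covering₂ [] [] _ = refl
∣∣-covering₂ {suc m} (a ∷ A) (b ∷ B) cov with ∣∣-covering₂ A B (cov ∘ suc) | a | b | cov zero
... | ih | true  | true  | _ = cong suc (begin
  ∣ A ∣ + suc ∣ B ∣     ≡⟨ +-suc ∣ A ∣ ∣ B ∣ ⟩
  suc (∣ A ∣ + ∣ B ∣)   ≡⟨ cong suc ih ⟩
  suc (m + ∣ A ∩ B ∣)   ≡⟨ +-suc m _ ⟨
  m + suc ∣ A ∩ B ∣     ∎)
  where open ≡-Reasoning
... | ih | true  | false | _ = cong suc ih
... | ih | false | true  | _ = trans (+-suc ∣ A ∣ ∣ B ∣) (cong suc ih)
... | ih | false | false | c = contradiction (c refl) λ ()

-- Since `A` covers with each of `B` and `E`, it covers with `B ∩ E`, so the two-set identity can be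
-- applied twice. This fixes the size sum of a conflict.
∣∣-covering₃ : ∀ {m} (A B E : Subset m) → Covering₂ A B → Covering₂ A E → Covering₂ B E →
  ∣ A ∣ + (∣ B ∣ + ∣ E ∣) ≡ m + m + ∣ A ∩ (B ∩ E) ∣
∣∣-covering₃ {m} A B E AB AE BE = begin
  ∣ A ∣ + (∣ B ∣ + ∣ E ∣)       ≡⟨ cong (∣ A ∣ +_) (∣∣-covering₂ B E BE) ⟩
  ∣ A ∣ + (m + ∣ B ∩ E ∣)       ≡⟨ x∙yz≈y∙xz ∣ A ∣ m _ ⟩
  m + (∣ A ∣ + ∣ B ∩ E ∣)       ≡⟨ cong (m +_) (∣∣-covering₂ A (B ∩ E) A∪BE) ⟩
  m + (m + ∣ A ∩ (B ∩ E) ∣)     ≡⟨ +-assoc m m _ ⟨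
  m + m + ∣ A ∩ (B ∩ E) ∣       ∎
  where
  open ≡-Reasoning
  A∪BE : Covering₂ A (B ∩ E)
  A∪BE x x∉A = trans (lookup-zipWith _∧_ x B E) (cong₂ _∧_ (AB x x∉A) (AE x x∉A))

∩-insert : ∀ {m} (A B : Subset m) x → lookup B x ≡ false → (A [ x ]≔ true) ∩ B ≡ A ∩ B
∩-insert (a ∷ A) (false ∷ B) zero    _   = cong (_∷ (A ∩ B)) (sym (∧-zeroʳ a))
∩-insert (a ∷ A) (b ∷ B)     (suc x) x∉B = cong ((a ∧ b) ∷_) (∩-insert A B x x∉B)

-- An intersection that misses 0 loses nothing when 0 is removed.
head-out : ∀ {m} (T : Family (suc m)) → ThreeWise T → ∀ {a b e A B E} → a ∧ (b ∧ e) ≡ false →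
  T (a ∷ A) ≡ true → T (b ∷ B) ≡ true → T (e ∷ E) ≡ true → 2 ≤ ∣ A ∩ (B ∩ E) ∣
head-out T int {a} {b} {e} {A} {B} {E} out hA hB hE = subst (2 ≤_)
  (trans (∣∷∣ (a ∧ (b ∧ e)) (A ∩ (B ∩ E))) (cong (λ h → bit h + ∣ A ∩ (B ∩ E) ∣) out))
  (int (a ∷ A) (b ∷ B) (e ∷ E) hA hB hE)

head-out₂ : ∀ {m} (T : Family (suc m)) → PairWise T → ∀ {a b A B} → a ∧ b ≡ false →
  T (a ∷ A) ≡ true → T (b ∷ B) ≡ true → 3 ≤ ∣ A ∩ B ∣
head-out₂ T int {a} {b} {A} {B} out hA hB = subst (3 ≤_)
  (trans (∣∷∣ (a ∧ b) (A ∩ B)) (cong (λ h → bit h + ∣ A ∩ B ∣) out))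
  (int (a ∷ A) (b ∷ B) hA hB)

module Reduce {m : ℕ} (T : Family (suc m)) (stable : ∀ x → Stable x T) (int : ThreeWise T) where

  T₀ T₁ : Family m
  T₀ A = T (false ∷ A)
  T₁ A = T (true ∷ A)

  reduce : (Subset m → Bool) → Family m
  reduce P A = T₀ A ∨ (T₁ A ∧ P A)

  reduce-⊎ : ∀ P A → reduce P A ≡ true → T₀ A ≡ true ⊎ (T₁ A ≡ true × P A ≡ true)
  reduce-⊎ P A h with T₀ A
  ... | true  = inj₁ refl
  ... | false = inj₂ (∧-conicalˡ (T₁ A) _ h , ∧-conicalʳ (T₁ A) _ h)

  reduce-head : ∀ P A → reduce P A ≡ true → ∃[ b ] (T (b ∷ A) ≡ true)
  reduce-head P A h with reduce-⊎ P A h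
  ... | inj₁ h₀       = false , h₀
  ... | inj₂ (h₁ , _) = true , h₁

  -- The only obstruction to removing 0 from all of T: sets of T₁ with a single common element
  -- besides 0. By stability no x can be missing from two of them, as it could replace 0 in one.
  record Conflict (A B E : Subset m) : Set where
    field
      one  : ∣ A ∩ (B ∩ E) ∣ ≡ 1
      cov₁ : Covering₂ A B
      cov₂ : Covering₂ A E
      cov₃ : Covering₂ B E

    sizes : ∣ A ∣ + (∣ B ∣ + ∣ E ∣) ≡ m + m + 1
    sizes = trans (∣∣-covering₃ A B E cov₁ cov₂ cov₃) (cong (m + m +_) one)

  conflict? : ∀ A B E → T₁ A ≡ true → T₁ B ≡ true → T₁ E ≡ true →
    2 ≤ ∣ A ∩ (B ∩ E) ∣ ⊎ Conflict A B E
  conflict? A B E hA hB hE with 2 ≤? ∣ A ∩ (B ∩ E) ∣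
  ... | yes p = inj₁ p
  ... | no ¬p = inj₂ record
    -- Removing 0 costs one common element, so the threshold 2 can only be missed by exactly one.
    { one  = ≤-antisym (≤-pred (≰⇒> ¬p)) (≤-pred (int _ _ _ hA hB hE))
    ; cov₁ = λ x x∉A → other x x∉A (λ x∉B → trans (lookup-zipWith _∧_ x B E) (cong (_∧ lookup E x) x∉B))
    ; cov₂ = λ x x∉A → other x x∉A (λ x∉E → trans (lookup-zipWith _∧_ x B E)
                (trans (cong (lookup B x ∧_) x∉E) (∧-zeroʳ (lookup B x))))
    ; cov₃ = λ x x∉B → ¬false (lookup E x) λ x∉E → ¬p (subst (λ D → 2 ≤ ∣ A ∩ D ∣) (∩-insert B E x x∉E)
                (head-out T int refl hA (stable x B hB x∉B) hE))
    }
    where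
    ¬false : ∀ b → (b ≡ false → ⊥) → b ≡ true
    ¬false true  _ = refl
    ¬false false f = ⊥-elim (f refl)
    -- Exchanging 0 for `x` in `A` takes 0 out of the intersection and adds nothing to it, because
    -- `x` is missing from `B ∩ E`.
    other : ∀ x → lookup A x ≡ false → ∀ {b} → (b ≡ false → lookup (B ∩ E) x ≡ false) → b ≡ true
    other x x∉A {b} x∉BE = ¬false b λ eq → ¬p (subst (λ D → 2 ≤ ∣ D ∣) (∩-insert A (B ∩ E) x (x∉BE eq))
      (head-out T int refl (stable x A hA x∉A) hB hE))

  -- Once one set comes from `T₀` the intersection avoids 0, so only triples from `T₁` can fail.
  reduce-ThreeWise : ∀ P →
    (∀ A B E → P A ≡ true → P B ≡ true → P E ≡ true → ¬ Conflict A B E) → ThreeWise (reduce P)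
  reduce-ThreeWise P free A B E hA hB hE
    with reduce-⊎ P A hA | reduce-⊎ P B hB | reduce-⊎ P E hE
       | reduce-head P A hA | reduce-head P B hB | reduce-head P E hE
  ... | inj₁ a | _ | _ | _ | (_ , b) | (_ , e) = head-out T int refl a b e
  ... | inj₂ _ | inj₁ b | _ | (h , a) | _ | (_ , e) = head-out T int (∧-zeroʳ h) a b e
  ... | inj₂ _ | inj₂ _ | inj₁ e | (g , a) | (h , b) | _ =
    head-out T int (trans (cong (g ∧_) (∧-zeroʳ h)) (∧-zeroʳ g)) a b e
  ... | inj₂ (a , pa) | inj₂ (b , pb) | inj₂ (e , pe) | _ | _ | _ with conflict? A B E a b e
  ...   | inj₁ p = p
  ...   | inj₂ c = ⊥-elim (free A B E pa pb pe c)

  -- Two sets of `T₁` with only two common elements besides 0 cover the ground set, by the same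
  -- exchange of 0 for a missing `x`. Their sizes then add up to m + 2, which the hypothesis on `P`
  -- excludes.
  reduce-PairWise : ∀ P → PairWise T →
    (∀ A B → P A ≡ true → P B ≡ true → ∣ A ∣ + ∣ B ∣ ≢ m + 2) → PairWise (reduce P)
  reduce-PairWise P int₂ free A B hA hB
    with reduce-⊎ P A hA | reduce-⊎ P B hB | reduce-head P A hA | reduce-head P B hB
  ... | inj₁ a | _ | _ | (_ , b) = head-out₂ T int₂ refl a b
  ... | inj₂ _ | inj₁ b | (h , a) | _ = head-out₂ T int₂ (∧-zeroʳ h) a b
  ... | inj₂ (a , pa) | inj₂ (b , pb) | _ | _ with 3 ≤? ∣ A ∩ B ∣
  ...   | yes p = p
  ...   | no ¬p = ⊥-elim (free A B pa pb (trans (∣∣-covering₂ A B cov)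
                    (cong (m +_) (≤-antisym (≤-pred (≰⇒> ¬p)) (≤-pred (int₂ _ _ a b))))))
    where
    cov : Covering₂ A B
    cov x x∉A with lookup B x in x∉B
    ... | true  = refl
    ... | false = ⊥-elim (¬p (subst (λ D → 3 ≤ ∣ D ∣) (∩-insert A B x x∉B)
                    (head-out₂ T int₂ refl (stable x A a x∉A) b)))

-- Conflict-free selections and how often a set is selected

-- The rounds (j , b). In a conflict the three sizes add up to 2m + 1, hence the case distinction at
-- (2m + 1) / 3. In the middle case containing both of two fixed elements and missing one of
-- them are each conflict-free: three pairwise disjoint complements cannot all meet a pair.
-- N ∸ j in Small mirrors j in Big, so that a set of size a is selected in at least
-- min (N + 1) (k - a + 1) of the values of j in either case.
module Selection (m′ N k : ℕ) (2k<n : k + k ≤ N + (2 + m′)) where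

  m : ℕ
  m = 2 + m′

  third : ℕ
  third = m + m + 1

  both : Subset m → Bool
  both A = lookup A zero ∧ lookup A (suc zero)

  Small Mid Big Sel : ℕ → Bool → Subset m → Set
  Small j b A = 3 * ∣ A ∣ < third × ∣ A ∣ + (N ∸ j) ≤ k
  Mid   j b A = 3 * ∣ A ∣ ≡ third × both A ≡ b
  Big   j b A = third < 3 * ∣ A ∣ × ∣ A ∣ + j ≤ k
  Sel   j b A = Small j b A ⊎ (Mid j b A ⊎ Big j b A)

  Sel? : ∀ j b A → Dec (Sel j b A)
  Sel? j b A =
    ((3 * ∣ A ∣ <? third) ×-dec (∣ A ∣ + (N ∸ j) ≤? k)) ⊎-dec
    (((3 * ∣ A ∣ ≟ third) ×-dec (both A ≟ᵇ b)) ⊎-dec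
     ((third <? 3 * ∣ A ∣) ×-dec (∣ A ∣ + j ≤? k)))

  -- The extra round. Three such sizes add up to at most 3(m + 1) / 2 < 2m + 1 because m ≥ 2, and
  -- two to at most m + 1 < m + 2, so neither a conflict nor its pairwise analogue can occur.
  Half? : ∀ (A : Subset m) → Dec (2 * ∣ A ∣ ≤ suc m)
  Half? A = 2 * ∣ A ∣ ≤? suc m

  sum-*3 : ∀ {a b e} → a + (b + e) ≡ third → 3 * a + (3 * b + 3 * e) ≡ third + (third + third)
  sum-*3 {a} {b} {e} eq = begin
    3 * a + (3 * b + 3 * e)   ≡⟨ lemma a b e ⟩
    3 * (a + (b + e))         ≡⟨ cong (3 *_) eq ⟩
    third + (third + (third + 0)) ≡⟨ cong (λ r → third + (third + r)) (+-identityʳ third) ⟩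
    third + (third + third)   ∎
    where
    open ≡-Reasoning
    lemma : ∀ a b e → 3 * a + (3 * b + 3 * e) ≡ 3 * (a + (b + e))
    lemma = solve-∀

  -- Twice the first bound plus the other two cancels j: 2a + b + e ≤ 4k - 2N ≤ 2m, below the 2m + 1
  -- of a conflict. Adding k + k + (N + N) keeps the computation free of subtraction.
  small-bound : ∀ {a b e j} → j ≤ N → a + (N ∸ j) ≤ k → b + j ≤ k → e + j ≤ k →
    a + (b + e) ≢ third
  small-bound {a} {b} {e} {j} j≤N pa pb pe eq = <-irrefl refl (begin-strict
    (m + m) + (k + k + (N + N))                        <⟨ +-monoˡ-< (k + k + (N + N)) (m<m+n (m + m) (s≤s z≤n)) ⟩
    third + (k + k + (N + N))                          ≡⟨ cong (_+ (k + k + (N + N))) eq ⟨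
    a + (b + e) + (k + k + (N + N))                    ≤⟨ m≤m+n _ a ⟩
    a + (b + e) + (k + k + (N + N)) + a                ≡⟨ regroup a b e N k ⟩
    (a + N) + (a + N) + (b + e) + (k + k)              ≤⟨ +-monoˡ-≤ (k + k) (+-monoˡ-≤ (b + e) (+-mono-≤ a+N a+N)) ⟩
    (k + j) + (k + j) + (b + e) + (k + k)              ≡⟨ regroup′ b e j k ⟩
    (b + j) + (e + j) + (k + k) + (k + k)              ≤⟨ +-monoˡ-≤ (k + k) (+-monoˡ-≤ (k + k) (+-mono-≤ pb pe)) ⟩
    (k + k) + (k + k) + (k + k)                        ≤⟨ +-monoˡ-≤ (k + k) (+-mono-≤ 2k<n 2k<n) ⟩
    (N + m) + (N + m) + (k + k)                        ≡⟨ regroup″ N m k ⟩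
    (m + m) + (k + k + (N + N))                        ∎)
    where
    open ≤-Reasoning
    regroup : ∀ a b e N k → a + (b + e) + (k + k + (N + N)) + a ≡ (a + N) + (a + N) + (b + e) + (k + k)
    regroup = solve-∀
    regroup′ : ∀ b e j k → (k + j) + (k + j) + (b + e) + (k + k) ≡ (b + j) + (e + j) + (k + k) + (k + k)
    regroup′ = solve-∀
    regroup″ : ∀ N m k → (N + m) + (N + m) + (k + k) ≡ (m + m) + (k + k + (N + N))
    regroup″ = solve-∀
    a+N : a + N ≤ k + j
    a+N = begin
      a + N             ≡⟨ cong (a +_) (m∸n+n≡m j≤N) ⟨
      a + (N ∸ j + j)   ≡⟨ +-assoc a (N ∸ j) j ⟨
      a + (N ∸ j) + j   ≤⟨ +-monoˡ-≤ j pa ⟩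
      k + j             ∎

  Low : ℕ → ℕ → Set
  Low j a = 3 * a ≤ third ⊎ (third < 3 * a × a + j ≤ k)

  Sel⇒Low : ∀ j b A → Sel j b A → Low j ∣ A ∣
  Sel⇒Low j b A (inj₁ (lt , _))        = inj₁ (<⇒≤ lt)
  Sel⇒Low j b A (inj₂ (inj₁ (eq , _))) = inj₁ (≤-reflexive eq)
  Sel⇒Low j b A (inj₂ (inj₂ big))      = inj₂ big

  -- If neither other set is big, the sum is too small. If one is big, the other is either big
  -- itself or no larger than it, so both satisfy the bound with j and `small-bound` applies.
  small-free : ∀ {a b e j} → j ≤ N → 3 * a < third → a + (N ∸ j) ≤ k → Low j b → Low j e →
    a + (b + e) ≢ third
  small-free {a} {b} {e} j≤N lt pa (inj₁ lb) (inj₁ le) eq =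
    <-irrefl (sum-*3 {a} {b} {e} eq) (+-mono-<-≤ lt (+-mono-≤ lb le))
  small-free j≤N lt pa (inj₂ (_ , pb)) (inj₂ (_ , pe)) eq = small-bound j≤N pa pb pe eq
  small-free {j = j} j≤N lt pa (inj₁ lb) (inj₂ (ge , pe)) eq =
    small-bound j≤N pa (≤-trans (+-monoˡ-≤ j (*-cancelˡ-≤ 3 (≤-trans lb (<⇒≤ ge)))) pe) pe eq
  small-free {j = j} j≤N lt pa (inj₂ (ge , pb)) (inj₁ le) eq =
    small-bound j≤N pa pb (≤-trans (+-monoˡ-≤ j (*-cancelˡ-≤ 3 (≤-trans le (<⇒≤ ge)))) pb) eq

  Upper : ℕ → Bool → Subset m → Set
  Upper j b A = Mid j b A ⊎ Big j b A

  Upper⇒≥ : ∀ j b A → Upper j b A → third ≤ 3 * ∣ A ∣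
  Upper⇒≥ j b A (inj₁ (eq , _)) = ≤-reflexive (sym eq)
  Upper⇒≥ j b A (inj₂ (gt , _)) = <⇒≤ gt

  big-free : ∀ {a b e} → third < 3 * a → third ≤ 3 * b → third ≤ 3 * e → a + (b + e) ≢ third
  big-free {a} {b} {e} ga gb ge eq =
    <-irrefl (sym (sum-*3 {a} {b} {e} eq)) (+-mono-<-≤ ga (+-mono-≤ gb ge))

  both-∩ : ∀ A B → both A ≡ true → both B ≡ true → both (A ∩ B) ≡ true
  both-∩ (a ∷ a′ ∷ _) (b ∷ b′ ∷ _) hA hB = cong₂ _∧_
    (cong₂ _∧_ (∧-conicalˡ a a′ hA) (∧-conicalˡ b b′ hB))
    (cong₂ _∧_ (∧-conicalʳ a a′ hA) (∧-conicalʳ b b′ hB))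

  both⇒2≤ : ∀ A → both A ≡ true → 2 ≤ ∣ A ∣
  both⇒2≤ (true ∷ true ∷ A) _ = s≤s (s≤s z≤n)

  one-missing : ∀ {a b} → a ∧ b ≡ false → (a ≡ false × b ≡ true) ⊎ b ≡ false
  one-missing {a}     {false} _ = inj₂ refl
  one-missing {false} {true}  _ = inj₁ (refl , refl)

  ∧-falseˡ : ∀ {a b} → a ∧ b ≡ false → b ≡ true → a ≡ false
  ∧-falseˡ {false} _ _ = refl
  ∧-falseˡ {true}  h b = trans (sym b) h

  ∧-falseʳ : ∀ {a b} → a ∧ b ≡ false → a ≡ true → b ≡ false
  ∧-falseʳ h refl = h

  false≢true : ∀ {b} → b ≡ false → b ≡ true → ⊥
  false≢true refl ()

  -- Pigeonhole: two of the three sets would miss the same one of the two fixed elements, against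
  -- covering.
  both-false : ∀ A B E → Covering₂ A B → Covering₂ A E → Covering₂ B E →
    both A ≡ false → both B ≡ false → both E ≡ false → ⊥
  both-false A B E AB AE BE hA hB hE with one-missing {lookup A zero} hA
  ... | inj₁ (0∉A , _) = false≢true (∧-falseʳ hE (AE zero 0∉A))
                           (BE (suc zero) (∧-falseʳ hB (AB zero 0∉A)))
  ... | inj₂ 1∉A       = false≢true (∧-falseˡ hE (AE (suc zero) 1∉A))
                           (BE zero (∧-falseˡ hB (AB (suc zero) 1∉A)))

  does≥1 : ∀ {P : Set} (P? : Dec P) → P → 1 ≤ bit (does P?)
  does≥1 P? p = ≤-reflexive (cong bit (sym (dec-true P? p)))

  count : Subset m → ℕ → ℕ
  count A j = bit (does (Sel? j true A)) + bit (does (Sel? j false A))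

  count≥2 : ∀ A j → (∀ b → Sel j b A) → 2 ≤ count A j
  count≥2 A j p = +-mono-≤ (does≥1 (Sel? j true A) (p true)) (does≥1 (Sel? j false A) (p false))

  count≥1 : ∀ A j → 3 * ∣ A ∣ ≡ third → 1 ≤ count A j
  count≥1 A j eq = go (both A) refl
    where
    go : ∀ b → both A ≡ b → 1 ≤ count A j
    go true  h = ≤-trans (does≥1 (Sel? j true A) (inj₂ (inj₁ (eq , h)))) (m≤m+n _ _)
    go false h = ≤-trans (does≥1 (Sel? j false A) (inj₂ (inj₁ (eq , h)))) (m≤n+m _ _)

  2d+1≤ : ∀ d → 2 * d + 1 ≤ suc d * 2
  2d+1≤ d = ≤-trans (n≤1+n _) (≤-reflexive (lemma d))
    where
    lemma : ∀ d → suc (2 * d + 1) ≡ suc d * 2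
    lemma = solve-∀

  -- A size other than (2m + 1) / 3 is selected for both b and at least d + 1 values of j, giving 2d
  -- + 2 rounds. At exactly that size there is one round per j, and these N + 1 rounds suffice: m ≤
  -- 2a, so 2k ≤ N + m yields 2d ≤ N.
  count-narrow : ∀ A d → k ≡ ∣ A ∣ + d → d ≤ N → 2 * d + 1 ≤ Σ≤ N (count A)
  count-narrow A d k≡ d≤N with <-cmp (3 * ∣ A ∣) third
  -- Reversing the sum turns the mirrored condition on `N ∸ j` into one on `j`, so that the first d
  -- + 1 terms count.
  ... | tri< lt _ _ = subst (2 * d + 1 ≤_) (Σ≤-reverse N (count A))
    (≤-trans (2d+1≤ d) (Σ≤-count N d 2 _ d≤N λ j j≤d → count≥2 A (N ∸ j) λ b →
      inj₁ (lt , subst (λ i → ∣ A ∣ + i ≤ k) (sym (m∸[m∸n]≡n (≤-trans j≤d d≤N)))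
                   (≤-trans (+-monoʳ-≤ ∣ A ∣ j≤d) (≤-reflexive (sym k≡))))))
  ... | tri> _ _ gt = ≤-trans (2d+1≤ d) (Σ≤-count N d 2 _ d≤N λ j j≤d → count≥2 A j λ b →
      inj₂ (inj₂ (gt , ≤-trans (+-monoʳ-≤ ∣ A ∣ j≤d) (≤-reflexive (sym k≡)))))
  ... | tri≈ _ eq _ = ≤-trans 2d+1≤N
      (≤-trans (≤-reflexive (sym (*-identityʳ (suc N)))) (Σ≤-count N N 1 _ ≤-refl λ j _ → count≥1 A j eq))
    where
    a : ℕ
    a = ∣ A ∣
    m≤2a : m ≤ a + a
    m≤2a = *-cancelˡ-≤ 3 (begin
      3 * m               ≤⟨ *-monoˡ-≤ m (n≤1+n 3) ⟩
      4 * m               ≤⟨ m≤m+n (4 * m) 2 ⟩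
      4 * m + 2           ≡⟨ lemma m ⟩
      third + third       ≡⟨ cong₂ _+_ eq eq ⟨
      3 * a + 3 * a       ≡⟨ *-distribˡ-+ 3 a a ⟨
      3 * (a + a)         ∎)
      where
      open ≤-Reasoning
      lemma : ∀ m → 4 * m + 2 ≡ (m + m + 1) + (m + m + 1)
      lemma = solve-∀
    2d+1≤N : 2 * d + 1 ≤ suc N
    2d+1≤N = +-cancelˡ-≤ m _ _ (begin
      m + (2 * d + 1)           ≤⟨ +-monoˡ-≤ (2 * d + 1) m≤2a ⟩
      a + a + (2 * d + 1)       ≡⟨ lemma a d ⟩
      suc ((a + d) + (a + d))   ≡⟨ cong (λ k → suc (k + k)) k≡ ⟨
      suc (k + k)               ≤⟨ s≤s 2k<n ⟩
      suc (N + m)               ≡⟨ cong suc (+-comm N m) ⟩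
      suc (m + N)               ≡⟨ +-suc m N ⟨
      m + suc N                 ∎)
      where
      open ≤-Reasoning
      lemma : ∀ a d → a + a + (2 * d + 1) ≡ suc ((a + d) + (a + d))
      lemma = solve-∀

  -- From 2(a + N + 1) ≤ 2k ≤ N + m follows 2a ≤ m, so `A` is small and selected in every round, the
  -- extra one included.
  count-wide : ∀ A → ∣ A ∣ + suc N ≤ k →
    suc N * 2 + 1 ≤ Σ≤ N (count A) + bit (does (Half? A))
  count-wide A wide = +-mono-≤
    (Σ≤-count N N 2 _ ≤-refl λ j j≤N → count≥2 A j λ b →
      inj₁ (small , ≤-trans (+-monoʳ-≤ a (≤-trans (m∸n≤m N j) (n≤1+n N))) wide))
    (does≥1 (Half? A) (≤-trans 2a≤m (n≤1+n m)))
    where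
    open ≤-Reasoning
    a : ℕ
    a = ∣ A ∣
    2a≤m : 2 * a ≤ m
    2a≤m = +-cancelˡ-≤ N _ _ (begin
      N + 2 * a                   ≤⟨ m≤m+n _ (2 + N) ⟩
      N + 2 * a + (2 + N)         ≡⟨ lemma a N ⟩
      (a + suc N) + (a + suc N)   ≤⟨ +-mono-≤ wide wide ⟩
      k + k                       ≤⟨ 2k<n ⟩
      N + m                       ∎)
      where
      lemma : ∀ a N → N + 2 * a + (2 + N) ≡ (a + suc N) + (a + suc N)
      lemma = solve-∀
    small : 3 * a < third
    small = begin-strict
      3 * a           ≡⟨⟩
      a + 2 * a       ≤⟨ +-mono-≤ (≤-trans (m≤n*m a 2) 2a≤m) 2a≤m ⟩
      m + m           <⟨ m<m+n (m + m) (s≤s z≤n) ⟩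
      third           ∎

  -- With a small set present, `small-free` applies after reordering. Otherwise a big set makes the
  -- size sum too large. Three sets of the middle size have both fixed elements in common if b is
  -- `true`, and contradict `both-false` if b is `false`.
  Sel-free : ∀ {T : Family (suc m)} {stable int} j b → j ≤ N → ∀ A B E →
    Sel j b A → Sel j b B → Sel j b E → ¬ Reduce.Conflict {m} T stable int A B E
  Sel-free j b j≤N A B E (inj₁ (lt , pa)) sB sE c =
    small-free j≤N lt pa (Sel⇒Low j b B sB) (Sel⇒Low j b E sE) (Reduce.Conflict.sizes c)
  Sel-free j b j≤N A B E sA@(inj₂ _) (inj₁ (lt , pb)) sE c =
    small-free {∣ B ∣} {∣ A ∣} j≤N lt pb (Sel⇒Low j b A sA) (Sel⇒Low j b E sE)
      (trans (x∙yz≈y∙xz (∣ B ∣) (∣ A ∣) (∣ E ∣)) (Reduce.Conflict.sizes c))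
  Sel-free j b j≤N A B E sA@(inj₂ _) sB@(inj₂ _) (inj₁ (lt , pe)) c =
    small-free {∣ E ∣} {∣ A ∣} j≤N lt pe (Sel⇒Low j b A sA) (Sel⇒Low j b B sB)
      (trans (trans (+-comm ∣ E ∣ _) (+-assoc (∣ A ∣) (∣ B ∣) (∣ E ∣))) (Reduce.Conflict.sizes c))
  Sel-free j b j≤N A B E (inj₂ (inj₂ (gt , _))) (inj₂ uB) (inj₂ uE) c =
    big-free {∣ A ∣} {∣ B ∣} {∣ E ∣} gt (Upper⇒≥ j b B uB) (Upper⇒≥ j b E uE) (Reduce.Conflict.sizes c)
  Sel-free j b j≤N A B E (inj₂ uA@(inj₁ _)) (inj₂ (inj₂ (gt , _))) (inj₂ uE) c =
    big-free {∣ B ∣} {∣ A ∣} gt (Upper⇒≥ j b A uA) (Upper⇒≥ j b E uE)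
      (trans (x∙yz≈y∙xz (∣ B ∣) (∣ A ∣) (∣ E ∣)) (Reduce.Conflict.sizes c))
  Sel-free j b j≤N A B E (inj₂ uA@(inj₁ _)) (inj₂ uB@(inj₁ _)) (inj₂ (inj₂ (gt , _))) c =
    big-free {∣ E ∣} {∣ A ∣} gt (Upper⇒≥ j b A uA) (Upper⇒≥ j b B uB)
      (trans (trans (+-comm ∣ E ∣ _) (+-assoc (∣ A ∣) (∣ B ∣) (∣ E ∣))) (Reduce.Conflict.sizes c))
  Sel-free j true j≤N A B E (inj₂ (inj₁ (_ , hA))) (inj₂ (inj₁ (_ , hB))) (inj₂ (inj₁ (_ , hE))) c =
    <-irrefl (sym (Reduce.Conflict.one c)) (both⇒2≤ (A ∩ (B ∩ E)) (both-∩ A (B ∩ E) hA (both-∩ B E hB hE)))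
  Sel-free j false j≤N A B E (inj₂ (inj₁ (_ , hA))) (inj₂ (inj₁ (_ , hB))) (inj₂ (inj₁ (_ , hE))) c =
    both-false A B E cov₁ cov₂ cov₃ hA hB hE
    where open Reduce.Conflict c

  Half-sum : ∀ {a b} → 2 * a ≤ suc m → 2 * b ≤ suc m → a + b ≢ m + 2
  Half-sum {a} {b} pa pb eq = <-irrefl refl (begin-strict
    suc m + suc m     <⟨ m<m+n (suc m + suc m) {2} (s≤s z≤n) ⟩
    suc m + suc m + 2 ≡⟨ lemma m ⟩
    2 * (m + 2)       ≡⟨ cong (2 *_) eq ⟨
    2 * (a + b)       ≡⟨ *-distribˡ-+ 2 a b ⟩
    2 * a + 2 * b     ≤⟨ +-mono-≤ pa pb ⟩
    suc m + suc m     ∎)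
    where
    open ≤-Reasoning
    lemma : ∀ m → suc m + suc m + 2 ≡ 2 * (m + 2)
    lemma = solve-∀

  Half-free : ∀ {a b e} → 2 * a ≤ suc m → 2 * b ≤ suc m → 2 * e ≤ suc m → a + (b + e) ≢ third
  Half-free {a} {b} {e} pa pb pe eq = <-irrefl refl (begin-strict
    suc m + (suc m + suc m)     <⟨ m<m+n _ {1 + m′} (s≤s z≤n) ⟩
    suc m + (suc m + suc m) + suc m′ ≡⟨ lemma m′ ⟩
    2 * third                   ≡⟨ cong (2 *_) eq ⟨
    2 * (a + (b + e))           ≡⟨ lemma′ a b e ⟩
    2 * a + (2 * b + 2 * e)     ≤⟨ +-mono-≤ pa (+-mono-≤ pb pe) ⟩
    suc m + (suc m + suc m)     ∎)
    where
    open ≤-Reasoning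
    lemma : ∀ m → (3 + m) + ((3 + m) + (3 + m)) + suc m ≡ 2 * ((2 + m) + (2 + m) + 1)
    lemma = solve-∀
    lemma′ : ∀ a b e → 2 * (a + (b + e)) ≡ 2 * a + (2 * b + 2 * e)
    lemma′ = solve-∀

-- Averaging over the rounds

C-pos : ∀ n k → k ≤ n → 1 ≤ n C k
C-pos n       zero    _         = ≤-refl
C-pos (suc n) (suc k) (s≤s k≤n) = begin
  1                       ≤⟨ C-pos n k k≤n ⟩
  n C k                   ≤⟨ m≤m+n _ _ ⟩
  n C k + n C suc k       ≡⟨ nCk+nC[k+1]≡[n+1]C[k+1] n k ⟩
  suc n C suc k           ∎
  where open ≤-Reasoning

does⇒ : ∀ {P : Set} (P? : Dec P) → does P? ≡ true → P
does⇒ (yes p) _ = p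

-- Here `T` lives on m + 1 elements and N others are already removed, so n = N + m + 1 and the
-- hypothesis `2k<n` reads 2k ≤ n - 1.
module Step (m′ N k : ℕ) (2k<n : k + k ≤ N + (2 + m′))
            (T : Family (3 + m′)) (stable : ∀ x → Stable x T) (int : ThreeWise T) where

  open Selection m′ N k 2k<n
  open Reduce T stable int

  selected : ℕ → Bool → Family m
  selected j b = reduce (λ A → does (Sel? j b A))

  halved : Family m
  halved = reduce (λ A → does (Half? A))

  selected-ThreeWise : ∀ j b → j ≤ N → ThreeWise (selected j b)
  selected-ThreeWise j b j≤N = reduce-ThreeWise _ λ A B E sA sB sE →
    Sel-free j b j≤N A B E (does⇒ (Sel? j b A) sA) (does⇒ (Sel? j b B) sB) (does⇒ (Sel? j b E) sE)

  halved-ThreeWise : ThreeWise halved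
  halved-ThreeWise = reduce-ThreeWise _ λ A B E hA hB hE c →
    Half-free {∣ A ∣} {∣ B ∣} {∣ E ∣} (does⇒ (Half? A) hA) (does⇒ (Half? B) hB) (does⇒ (Half? E) hE)
      (Conflict.sizes c)

  halved-PairWise : PairWise T → PairWise halved
  halved-PairWise int₂ = reduce-PairWise _ int₂ λ A B hA hB →
    Half-sum {∣ A ∣} {∣ B ∣} (does⇒ (Half? A) hA) (does⇒ (Half? B) hB)

  -- The number of rounds: two for each j from 0 to N, and `halved`.
  L : ℕ
  L = suc N * 2 + 1

  -- Weights for a trace of size a: `u` with 0 added and `v` without it before the removal, `z`
  -- afterwards.
  u v z : ℕ → ℕ
  u a = wt N k (suc a)
  v a = wt N k a
  z a = wt (suc N) k a

  -- With d = k - a, the absorption identity reads (N + 1) u = d z, so A has to be selected in at least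
  -- 2 d + 1 of the L rounds, counting halved as a round.
  enough : ∀ A → L * u ∣ A ∣ ≤ (Σ≤ N (count A) + bit (does (Half? A))) * z ∣ A ∣
  enough A with ∣ A ∣ ≤? k
  ... | no a≰k = ≤-trans (≤-reflexive
    (trans (cong (L *_) (wt-0 N k (suc ∣ A ∣) (m<n⇒m<1+n (≰⇒> a≰k)))) (*-zeroʳ L))) z≤n
  ... | yes a≤k with k ∸ ∣ A ∣ ≤? N
  ...   | no wide = *-mono-≤ (count-wide A (≤-trans (+-monoʳ-≤ a (≰⇒> wide)) (≤-reflexive (m+[n∸m]≡n a≤k)))) u≤z
    where
    a = ∣ A ∣
    u≤z : u a ≤ z a
    u≤z = ≤-trans (m≤m+n _ _) (≤-reflexive (wt-pascal N k a))
  ...   | yes d≤N = begin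
    L * u a                                   ≡⟨ lemma (suc N) (u a) ⟩
    2 * (suc N * u a) + u a                   ≡⟨ cong (λ w → 2 * w + u a) absorb ⟩
    2 * (d * z a) + u a                       ≤⟨ +-monoʳ-≤ (2 * (d * z a)) (≤-trans (m≤m+n _ _) (≤-reflexive (wt-pascal N k a))) ⟩
    2 * (d * z a) + z a                       ≡⟨ lemma′ d (z a) ⟩
    (2 * d + 1) * z a                         ≤⟨ *-monoˡ-≤ (z a) (≤-trans (count-narrow A d k≡ d≤N) (m≤m+n _ _)) ⟩
    (Σ≤ N (count A) + bit (does (Half? A))) * z a ∎
    where
    open ≤-Reasoning
    a d : ℕ
    a = ∣ A ∣
    d = k ∸ a
    k≡ : k ≡ a + d
    k≡ = sym (m+[n∸m]≡n a≤k)
    lemma : ∀ n u → (n * 2 + 1) * u ≡ 2 * (n * u) + u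
    lemma = solve-∀
    lemma′ : ∀ d z → 2 * (d * z) + z ≡ (2 * d + 1) * z
    lemma′ = solve-∀
    absorb : suc N * u a ≡ d * z a
    absorb = +-cancelʳ-≡ (a * z a) _ _ (trans (wt-absorb N k a)
      (trans (cong (_* z a) (trans k≡ (+-comm a d))) (*-distribʳ-+ (z a) d a)))

  share : Subset m → ℕ → ℕ
  share A j = bit (selected j true A) * z ∣ A ∣ + bit (selected j false A) * z ∣ A ∣

  pointwise : ∀ A → L * (bit (T₁ A) * u ∣ A ∣ + bit (T₀ A) * v ∣ A ∣) ≤
    Σ≤ N (share A) + bit (halved A) * z ∣ A ∣
  pointwise A = go (T₀ A) (T₁ A)
    where
    open ≤-Reasoning
    a : ℕ
    a = ∣ A ∣
    kept : Bool → Bool → Bool → ℕ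
    kept t₀ t₁ p = bit (t₀ ∨ (t₁ ∧ p)) * z a
    go : ∀ t₀ t₁ → L * (bit t₁ * u a + bit t₀ * v a) ≤
      Σ≤ N (λ j → kept t₀ t₁ (does (Sel? j true A)) + kept t₀ t₁ (does (Sel? j false A))) +
      kept t₀ t₁ (does (Half? A))
    -- A trace in `T₀` survives every round, and by Pascal's rule its weight `z` pays for the set
    -- with 0 as well.
    go true t₁ = begin
      L * (bit t₁ * u a + 1 * v a)                ≤⟨ *-monoʳ-≤ L (+-monoˡ-≤ (1 * v a) (*-monoˡ-≤ (u a) (bit≤1 t₁))) ⟩
      L * (1 * u a + 1 * v a)                     ≡⟨ cong (L *_) (cong₂ _+_ (*-identityˡ (u a)) (*-identityˡ (v a))) ⟩
      L * (u a + v a)                             ≡⟨ cong (L *_) (wt-pascal N k a) ⟩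
      L * z a                                     ≡⟨ lemma (suc N) (z a) ⟩
      suc N * (1 * z a + 1 * z a) + 1 * z a       ≡⟨ cong (_+ 1 * z a) (Σ≤-const N _) ⟨
      Σ≤ N (λ _ → 1 * z a + 1 * z a) + 1 * z a    ∎
      where
      bit≤1 : ∀ b → bit b ≤ 1
      bit≤1 true  = ≤-refl
      bit≤1 false = z≤n
      lemma : ∀ n z → (n * 2 + 1) * z ≡ n * (1 * z + 1 * z) + 1 * z
      lemma = solve-∀
    go false false = ≤-trans (≤-reflexive (*-zeroʳ L)) z≤n
    go false true  = begin
      L * (1 * u a + 0)                           ≡⟨ cong (L *_) (trans (+-identityʳ _) (*-identityˡ (u a))) ⟩
      L * u a                                     ≤⟨ enough A ⟩
      (Σ≤ N (count A) + bit (does (Half? A))) * z a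
        ≡⟨ *-distribʳ-+ (z a) (Σ≤ N (count A)) _ ⟩
      Σ≤ N (count A) * z a + bit (does (Half? A)) * z a
        ≡⟨ cong (_+ bit (does (Half? A)) * z a) (trans (sym (Σ≤-*ʳ N (count A) (z a)))
             (Σ≤-cong N λ j _ → *-distribʳ-+ (z a) (bit (does (Sel? j true A))) _)) ⟩
      Σ≤ N (λ j → bit (does (Sel? j true A)) * z a + bit (does (Sel? j false A)) * z a) +
        bit (does (Half? A)) * z a ∎

  average : L * W (suc m) (wt N k) T ≤
    Σ≤ N (λ j → W m z (selected j true) + W m z (selected j false)) + W m z halved
  average = begin
    L * W (suc m) (wt N k) T
      ≡⟨ cong (L *_) (Σ⊆-+ m (λ A → bit (T₁ A) * u ∣ A ∣) (λ A → bit (T₀ A) * v ∣ A ∣)) ⟨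
    L * Σ⊆ m (λ A → bit (T₁ A) * u ∣ A ∣ + bit (T₀ A) * v ∣ A ∣)
      ≡⟨ Σ⊆-*ˡ m L (λ A → bit (T₁ A) * u ∣ A ∣ + bit (T₀ A) * v ∣ A ∣) ⟨
    Σ⊆ m (λ A → L * (bit (T₁ A) * u ∣ A ∣ + bit (T₀ A) * v ∣ A ∣))
      ≤⟨ Σ⊆-mono m pointwise ⟩
    Σ⊆ m (λ A → Σ≤ N (share A) + bit (halved A) * z ∣ A ∣)
      ≡⟨ Σ⊆-+ m (λ A → Σ≤ N (share A)) (λ A → bit (halved A) * z ∣ A ∣) ⟩
    Σ⊆ m (λ A → Σ≤ N (share A)) + W m z halved
      ≡⟨ cong (_+ W m z halved) (Σ⊆-Σ≤ m N (λ j A → share A j)) ⟩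
    Σ≤ N (λ j → Σ⊆ m (λ A → share A j)) + W m z halved
      ≡⟨ cong (_+ W m z halved) (Σ≤-cong N λ j _ → Σ⊆-+ m
           (λ A → bit (selected j true A) * z ∣ A ∣) (λ A → bit (selected j false A) * z ∣ A ∣)) ⟩
    Σ≤ N (λ j → W m z (selected j true) + W m z (selected j false)) + W m z halved ∎
    where open ≤-Reasoning

  module _ {B : ℕ} (bound : ∀ U → ThreeWise U → W m z U ≤ B) where

    private
      selected-bound : Σ≤ N (λ j → W m z (selected j true) + W m z (selected j false)) ≤ suc N * 2 * B
      selected-bound = begin
        Σ≤ N (λ j → W m z (selected j true) + W m z (selected j false))
          ≤⟨ Σ≤-mono N (λ j j≤N → +-mono-≤
               (bound _ (selected-ThreeWise j true j≤N)) (bound _ (selected-ThreeWise j false j≤N))) ⟩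
        Σ≤ N (λ _ → B + B)  ≡⟨ Σ≤-const N (B + B) ⟩
        suc N * (B + B)     ≡⟨ lemma (suc N) B ⟩
        suc N * 2 * B       ∎
        where
        open ≤-Reasoning
        lemma : ∀ n B → n * (B + B) ≡ n * 2 * B
        lemma = solve-∀

      split-L : L * B ≡ suc N * 2 * B + B
      split-L = trans (*-distribʳ-+ B (suc N * 2) 1) (cong (suc N * 2 * B +_) (*-identityˡ B))

    W≤ : W (suc m) (wt N k) T ≤ B
    W≤ = *-cancelˡ-≤ L (≤-trans average
      (≤-trans (+-mono-≤ selected-bound (bound _ halved-ThreeWise)) (≤-reflexive (sym split-L))))

    -- One strict inequality among the rounds makes the average strict; `halved` is taken because
    -- `halved-PairWise` makes the strict induction hypothesis available for it.
    W< : W m z halved < B → W (suc m) (wt N k) T < B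
    W< lt = *-cancelˡ-< L _ _ (≤-<-trans average
      (<-≤-trans (+-mono-≤-< selected-bound lt) (≤-reflexive (sym split-L))))

-- Induction on the number of elements left

wt-pos : ∀ N k → 2 ≤ k → k + k < N + 2 → 0 < wt N k 2
wt-pos N (suc (suc k)) (s≤s (s≤s z≤n)) 2k<n = C-pos N k (+-cancelʳ-≤ 2 k N (begin
  k + 2                     ≡⟨ +-comm k 2 ⟩
  2 + k                     ≤⟨ m≤m+n (2 + k) (2 + k) ⟩
  (2 + k) + (2 + k)         ≤⟨ <⇒≤ 2k<n ⟩
  N + 2                     ∎))
  where open ≤-Reasoning

module _ (k : ℕ) (2≤k : 2 ≤ k) where

  -- With n = N + 2 + m′ the bound is C(n - 2, k - 2), which does not change as elements are
  -- removed.
  Bounded : ℕ → ℕ → Set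
  Bounded m′ N = ∀ (T : Family (2 + m′)) → ThreeWise T →
    W (2 + m′) (wt N k) T ≤ wt (N + m′) k 2 ×
    (PairWise T → W (2 + m′) (wt N k) T < wt (N + m′) k 2)

  -- On two elements only the full set meets itself in two elements, and the pairwise condition
  -- excludes even that one; positivity of the bound gives strictness.
  bounded-base : ∀ N → k + k < N + 2 → Bounded 0 N
  bounded-base N 2k<n T int =
    subst (λ B → W 2 (wt N k) T ≤ B × (PairWise T → W 2 (wt N k) T < B))
      (cong (λ N → wt N k 2) (sym (+-identityʳ N)))
      ( subst (_≤ wt N k 2) (sym W≡) (bit*≤ (T (true ∷ true ∷ [])) _)
      , λ int₂ → subst (_< wt N k 2)
          (sym (trans W≡ (cong (λ b → bit b * wt N k 2) (absent₂ int₂)))) pos)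
    where
    absent : ∀ A → ¬ (2 ≤ ∣ A ∩ (A ∩ A) ∣) → T A ≡ false
    absent A ¬2≤ with T A in h
    ... | true  = ⊥-elim (¬2≤ (int A A A h h h))
    ... | false = refl
    absent₂ : PairWise T → T (true ∷ true ∷ []) ≡ false
    absent₂ int₂ with T (true ∷ true ∷ []) in h
    ... | true  = contradiction (int₂ _ _ h h) λ { (s≤s (s≤s ())) }
    ... | false = refl
    W≡ : W 2 (wt N k) T ≡ bit (T (true ∷ true ∷ [])) * wt N k 2
    W≡ = trans
      (cong₂ _+_
        (cong (λ b → bit (T (true ∷ true ∷ [])) * wt N k 2 + bit b * wt N k 1)
          (absent (true ∷ false ∷ []) λ { (s≤s ()) }))
        (cong₂ (λ b c → bit b * wt N k 1 + bit c * wt N k 0)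
          (absent (false ∷ true ∷ []) λ { (s≤s ()) })
          (absent (false ∷ false ∷ []) λ ())))
      (trans (+-identityʳ _) (+-identityʳ _))
    bit*≤ : ∀ b w → bit b * w ≤ w
    bit*≤ true  w = ≤-reflexive (+-identityʳ w)
    bit*≤ false w = z≤n
    pos : 0 < wt N k 2
    pos = wt-pos N k 2≤k 2k<n

  -- Shifting makes the family stable at equal weight; the removal of 0 then trades one remaining
  -- element for one more in `N`, and the induction hypothesis bounds every round.
  bounded : ∀ m′ N → k + k < N + (2 + m′) → Bounded m′ N
  bounded zero     N 2k<n T int = bounded-base N 2k<n T int
  bounded (suc m′) N 2k<n T int rewrite +-suc N m′ =
    subst (_≤ wt (suc (N + m′)) k 2) weight (W≤ (λ U int → proj₁ (ih U int))) ,
    λ int₂ → subst (_< wt (suc (N + m′)) k 2) weight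
      (W< (λ U int → proj₁ (ih U int)) (proj₂ (ih halved halved-ThreeWise) (halved-PairWise (pairWise int₂))))
    where
    open Normal (normalise (wt N k) T)
    2k<n′ : k + k < suc N + (2 + m′)
    2k<n′ = subst (k + k <_) (+-suc N (2 + m′)) 2k<n
    ih : Bounded m′ (suc N)
    ih = bounded m′ (suc N) 2k<n′
    open Step m′ N k (≤-pred 2k<n′) family stable (threeWise int)

-- From lists to weighted families

_≟ₛ_ : ∀ {n} (A B : Subset n) → Dec (A ≡ B)
_≟ₛ_ = ≡-dec _≟ᵇ_

_∈?_ : ∀ {n} (A : Subset n) F → Dec (A ∈ F)
_∈?_ = DecPropositional._∈?_ _≟ₛ_

char : ∀ {n} → List (Subset n) → Family n
char F A = does (A ∈? F)

Σ⊆-term : ∀ n (f : Subset n → ℕ) A → f A ≤ Σ⊆ n f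
Σ⊆-term zero    f []          = ≤-refl
Σ⊆-term (suc n) f (true  ∷ A) = ≤-trans (Σ⊆-term n (f ∘ (true ∷_)) A) (m≤m+n _ _)
Σ⊆-term (suc n) f (false ∷ A) = ≤-trans (Σ⊆-term n (f ∘ (false ∷_)) A) (m≤n+m _ _)

char-∷ : ∀ {n} (A : Subset n) F → ¬ (A ∈ F) → ∀ X →
  bit (does (X ≟ₛ A)) + bit (char F X) ≤ bit (char (A ∷ F) X)
char-∷ A F A∉F X with X ≟ₛ A
... | yes refl = subst (λ b → suc (bit b) ≤ 1) (sym (dec-false (X ∈? F) A∉F)) ≤-refl
... | no _     = ≤-refl

wt-full : ∀ k → wt 0 k k ≡ 1
wt-full zero    = refl
wt-full (suc k) = wt-full k

-- With N = 0 every k-set has weight 1, so each list entry contributes its own term; absence of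
-- duplicates keeps these terms distinct.
length≤W : ∀ {n k} (F : List (Subset n)) → IsKFamily n k F → length F ≤ W n (wt 0 k) (char F)
length≤W [] _ = z≤n
length≤W {n} {k} (A ∷ F) (A∉F ∷ unique , A≡k ∷ sizes) = begin
  1 + length F
    ≤⟨ +-mono-≤ one (length≤W F (unique , sizes)) ⟩
  Σ⊆ n single + W n (wt 0 k) (char F)
    ≡⟨ Σ⊆-+ n single (λ X → bit (char F X) * wt 0 k ∣ X ∣) ⟨
  Σ⊆ n (λ X → single X + bit (char F X) * wt 0 k ∣ X ∣)
    ≤⟨ Σ⊆-mono n (λ X → ≤-trans
         (≤-reflexive (sym (*-distribʳ-+ (wt 0 k ∣ X ∣) (bit (does (X ≟ₛ A))) (bit (char F X)))))
         (*-monoˡ-≤ (wt 0 k ∣ X ∣) (char-∷ A F (All¬⇒¬Any A∉F) X))) ⟩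
  W n (wt 0 k) (char (A ∷ F)) ∎
  where
  open ≤-Reasoning
  single : Subset n → ℕ
  single X = bit (does (X ≟ₛ A)) * wt 0 k ∣ X ∣
  one : 1 ≤ Σ⊆ n single
  one = ≤-trans
    (≤-reflexive (sym (cong₂ _*_ (cong bit (dec-true (A ≟ₛ A) refl)) (trans (cong (wt 0 k) A≡k) (wt-full k)))))
    (Σ⊆-term n single A)

char-ThreeWise : ∀ {n} (F : List (Subset n)) → ThreeWiseTwoIntersecting F → ThreeWise (char F)
char-ThreeWise F int A B E hA hB hE = int (does⇒ (A ∈? F) hA) (does⇒ (B ∈? F) hB) (does⇒ (E ∈? F) hE)

∣∩∣-full : ∀ {n} (G S : Subset n) → ∣ S ∣ ≤ ∣ G ∩ S ∣ → S ⊆ G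
∣∩∣-full (true  ∷ G) (true ∷ S)  le       here      = here
∣∩∣-full (false ∷ G) (true ∷ S)  le       _         = ⊥-elim (<-irrefl refl (≤-trans le (∣p∩q∣≤∣q∣ G S)))
∣∩∣-full (true  ∷ G) (true ∷ S)  (s≤s le) (there x) = there (∣∩∣-full G S le x)
∣∩∣-full (true  ∷ G) (false ∷ S) le       (there x) = there (∣∩∣-full G S le x)
∣∩∣-full (false ∷ G) (false ∷ S) le       (there x) = there (∣∩∣-full G S le x)

-- A full star attaining the bound

kSubsets : (n k : ℕ) → List (Subset n)
kSubsets zero    zero    = [] ∷ []
kSubsets zero    (suc k) = []
kSubsets (suc n) zero    = map (false ∷_) (kSubsets n zero)
kSubsets (suc n) (suc k) = map (true ∷_) (kSubsets n k) ++ map (false ∷_) (kSubsets n (suc k))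

kSubsets-length : ∀ n k → length (kSubsets n k) ≡ n C k
kSubsets-length zero    zero    = refl
kSubsets-length zero    (suc k) = sym (k>n⇒nCk≡0 (s≤s (z≤n {k})))
kSubsets-length (suc n) zero    = trans (length-map _ (kSubsets n zero)) (kSubsets-length n zero)
kSubsets-length (suc n) (suc k) = begin
  length (map (true ∷_) (kSubsets n k) ++ map (false ∷_) (kSubsets n (suc k)))
    ≡⟨ length-++ (map (true ∷_) (kSubsets n k)) ⟩
  length (map (true ∷_) (kSubsets n k)) + length (map (false ∷_) (kSubsets n (suc k)))
    ≡⟨ cong₂ _+_ (length-map _ (kSubsets n k)) (length-map _ (kSubsets n (suc k))) ⟩
  length (kSubsets n k) + length (kSubsets n (suc k))
    ≡⟨ cong₂ _+_ (kSubsets-length n k) (kSubsets-length n (suc k)) ⟩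
  n C k + n C suc k
    ≡⟨ nCk+nC[k+1]≡[n+1]C[k+1] n k ⟩
  suc n C suc k ∎
  where open ≡-Reasoning

kSubsets-IsKFamily : ∀ n k → IsKFamily n k (kSubsets n k)
kSubsets-IsKFamily zero    zero    = ([] ∷ []) , (refl ∷ [])
kSubsets-IsKFamily zero    (suc k) = [] , []
kSubsets-IsKFamily (suc n) zero    with kSubsets-IsKFamily n zero
... | unique , sizes = Unique-map⁺ ∷-injectiveʳ unique , All-map⁺ sizes
kSubsets-IsKFamily (suc n) (suc k) with kSubsets-IsKFamily n k | kSubsets-IsKFamily n (suc k)
... | unique₁ , sizes₁ | unique₀ , sizes₀ =
  Unique-++⁺ (Unique-map⁺ ∷-injectiveʳ unique₁) (Unique-map⁺ ∷-injectiveʳ unique₀) disjoint ,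
  All-++⁺ (All-map⁺ (All.map (cong suc) sizes₁)) (All-map⁺ sizes₀)
  where
  disjoint : ∀ {A} → ¬ (A ∈ map (true ∷_) (kSubsets n k) × A ∈ map (false ∷_) (kSubsets n (suc k)))
  disjoint (p , q) with ∈-map⁻ (true ∷_) p | ∈-map⁻ (false ∷_) q
  ... | _ , _ , refl | _ , _ , ()

star : ∀ n k → List (Subset (2 + n))
star n k = map (true ∷_) (map (true ∷_) (kSubsets n k))

star-IsKFamily : ∀ n k → IsKFamily (2 + n) (2 + k) (star n k)
star-IsKFamily n k with kSubsets-IsKFamily n k
... | unique , sizes = Unique-map⁺ ∷-injectiveʳ (Unique-map⁺ ∷-injectiveʳ unique) ,
                       All-map⁺ (All-map⁺ (All.map (cong (2 +_)) sizes))

star-ThreeWise : ∀ n k → ThreeWiseTwoIntersecting (star n k)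
star-ThreeWise n k hA hB hE with head∈ hA | head∈ hB | head∈ hE
  where
  head∈ : ∀ {A} → A ∈ star n k → ∃[ A′ ] (A ≡ true ∷ true ∷ A′)
  head∈ h with ∈-map⁻ (true ∷_) h
  ... | _ , h′ , refl with ∈-map⁻ (true ∷_) h′
  ...   | A′ , _ , refl = A′ , refl
... | _ , refl | _ , refl | _ , refl = s≤s (s≤s z≤n)

-- The upper bound and the extremal families

module Main (n k : ℕ) (2k<n : (2 + k) + (2 + k) < 2 + n) where

  -- The start of the descent, with nothing removed; the bound `wt n (2 + k) 2` computes to `n C k`.
  bounds : Bounded (2 + k) (s≤s (s≤s z≤n)) n 0
  bounds = bounded (2 + k) (s≤s (s≤s z≤n)) n 0 2k<n

  upper : ∀ F → IsKFamily (2 + n) (2 + k) F → ThreeWiseTwoIntersecting F → length F ≤ n C k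
  upper F kF int = ≤-trans (length≤W F kF) (proj₁ (bounds (char F) (char-ThreeWise F int)))

  strict : ∀ F → IsKFamily (2 + n) (2 + k) F → ThreeWiseTwoIntersecting F →
    PairWise (char F) → length F < n C k
  strict F kF int int₂ = ≤-<-trans (length≤W F kF) (proj₂ (bounds (char F) (char-ThreeWise F int)) int₂)

  -- Every member meets the two-element set `A ∩ B` in two elements, hence contains it. Maximality
  -- does the rest: a missing k-set above `A ∩ B` could be added to `F`, exceeding `upper`.
  full-star : ∀ F → IsKFamily (2 + n) (2 + k) F → ThreeWiseTwoIntersecting F → length F ≡ n C k →
    ∀ {A B} → A ∈ F → B ∈ F → ∣ A ∩ B ∣ ≤ 2 → IsFullStar (2 + k) (A ∩ B) F
  full-star F kF@(unique , sizes) int eq {A} {B} A∈F B∈F small =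
    ≤-antisym small (subst (λ X → 2 ≤ ∣ A ∩ X ∣) (∩-idem B) (int A∈F B∈F B∈F)) ,
    λ G → mk⇔ {B = ∣ G ∣ ≡ 2 + k × S ⊆ G} (λ G∈F → All.lookup sizes G∈F , S⊆ G∈F) (full G)
    where
    S : Subset (2 + n)
    S = A ∩ B
    S⊆ : ∀ {G} → G ∈ F → S ⊆ G
    S⊆ {G} G∈F = ∣∩∣-full G S (≤-trans small (int G∈F A∈F B∈F))
    2≤S : 2 ≤ ∣ S ∣
    2≤S = subst (λ X → 2 ≤ ∣ A ∩ X ∣) (∩-idem B) (int A∈F B∈F B∈F)
    full : ∀ G → ∣ G ∣ ≡ 2 + k × S ⊆ G → G ∈ F
    full G (G≡k , S⊆G) with G ∈? F
    ... | yes G∈F = G∈F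
    ... | no G∉F = ⊥-elim (<-irrefl eq (upper (G ∷ F) (¬Any⇒All¬ F G∉F ∷ unique , G≡k ∷ sizes) int′))
      where
      S⊆′ : ∀ {H} → H ∈ (G ∷ F) → S ⊆ H
      S⊆′ (here refl) = S⊆G
      S⊆′ (there H∈F) = S⊆ H∈F
      int′ : ThreeWiseTwoIntersecting (G ∷ F)
      int′ hP hQ hR = ≤-trans 2≤S (p⊆q⇒∣p∣≤∣q∣ λ x∈S →
        x∈p∩q⁺ (S⊆′ hP x∈S , x∈p∩q⁺ (S⊆′ hQ x∈S , S⊆′ hR x∈S)))

  unique-star : ∀ F → IsKFamily (2 + n) (2 + k) F → ThreeWiseTwoIntersecting F → length F ≡ n C k →
    ∃[ S ] IsFullStar (2 + k) S F
  unique-star F kF int eq with any? (λ A → any? (λ B → ∣ A ∩ B ∣ ≤? 2) F) F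
  ... | yes p with find p
  ...   | A , A∈F , q with find q
  ...     | B , B∈F , small = A ∩ B , full-star F kF int eq A∈F B∈F small
  -- All pairs now meet in at least three elements, so `strict` contradicts the assumed size.
  unique-star F kF int eq | no ¬p = ⊥-elim (<-irrefl eq (strict F kF int λ A B hA hB →
    ≰⇒> λ small → ¬p (lose (does⇒ (A ∈? F) hA) (lose (does⇒ (B ∈? F) hB) small))))

theorem1p4 : (n k : ℕ) → 4 ≤ 2 * k → 2 * k < n →
    (∃[ F ] (IsKFamily n k F × ThreeWiseTwoIntersecting F × length F ≡ (n ∸ 2) C (k ∸ 2)))
    × (∀ (F : List (Subset n)) → IsKFamily n k F → ThreeWiseTwoIntersecting F →
    length F ≤ (n ∸ 2) C (k ∸ 2))
    × (∀ (F : List (Subset n)) → IsKFamily n k F → ThreeWiseTwoIntersecting F →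
    length F ≡ (n ∸ 2) C (k ∸ 2) → ∃[ T ] IsFullStar k T F)
theorem1p4 zero          _             _  ()
theorem1p4 (suc zero)    zero          () _
theorem1p4 (suc zero)    (suc k)       _  (s≤s ())
theorem1p4 (suc (suc n)) zero          () _
theorem1p4 (suc (suc n)) (suc zero)    (s≤s (s≤s ())) _
theorem1p4 (suc (suc n)) (suc (suc k)) _  2k<n =
  (star n k , star-IsKFamily n k , star-ThreeWise n k ,
    trans (length-map _ (map (true ∷_) (kSubsets n k)))
      (trans (length-map _ (kSubsets n k)) (kSubsets-length n k))) ,
  upper , unique-star
  where
  open Main n k (subst (_< 2 + n) (cong (2 + k +_) (+-identityʳ (2 + k))) 2k<n)
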